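{- Let $\mathcal{L}\subseteq\mathrm{Scat}$ be nonempty, downward $\preceq$-closed and ccs. Then $(\mathrm{LO},\trianglelefteq^{\mathcal{L}}_{\mathrm{LO}})$ has the fractal property with respect to its upper cones, that is, for every $L_0\in\mathrm{LO}$, $(\mathrm{LO},\trianglelefteq^{\mathcal{L}}_{\mathrm{LO}})$ embeds into $(L_0{\uparrow^{\mathcal{L}}},\trianglelefteq^{\mathcal{L}}_{\mathrm{LO}})$, where $L_0{\uparrow^{\mathcal{L}}}=\{L\in\mathrm{LO}: L_0\trianglelefteq^{\mathcal{L}}_{\mathrm{LO}}L\}$.
   Context: Linear orders are reflexive and nonempty. $L\preceq L'$ means there is an embedding $f:L\to L'$, i.e. $x\le_L y\iff f(x)\le_{L'}f(y)$. $\mathrm{LO}\subseteq 2^{\mathbb{N}\times\mathbb{N}}$ is the set of (codes for) linear orders with domain $\mathbb{N}$; $\mathrm{Fin}$ is the set of (codes for) nonempty linear orders on finite subsets of $\mathbb{N}$; $\mathrm{Lin}=\mathrm{Fin}\cup\mathrm{LO}$; $\mathrm{Scat}\subseteq\mathrm{Lin}$ is the set of scattered ones (those $L$ with $\mathbb{Q}\not\preceq L$). A class $\mathcal{L}\subseteq\mathrm{Lin}$ is downward $\preceq$-closed if $K\in\mathrm{Lin}$ and $K\preceq L\in\mathcal{L}$ imply $K\in\mathcal{L}$; membership in $\mathcal{L}$ is meant up to isomorphism. A subset $I$ of a linear order $L$ is convex if $x\le_L y\le_L z$ and $x,z\in I$ imply $y\in I$. For $A,B\subseteq L$ write $A\le_L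 B$ (resp. $A<_L B$) if $a\le_L b$ (resp. $a<_L b$) for all $a\in A$, $b\in B$. A $K$-convex partition of $L$ is a partition $(L_k)_{k\in K}$ of $L$ (into nonempty sets) such that $k<_K k'\iff L_k<_L L_{k'}$. The relation $L\trianglelefteq^{\mathcal{L}}L'$ holds iff there are $K\in\mathcal{L}$, a $K$-convex partition $(L_k)_{k\in K}$ of $L$, and an embedding $f$ of $L$ into $L'$ such that $f(L_k)$ is a convex subset of $L'$ for every $k\in K$. $\trianglelefteq^{\mathcal{L}}_{\mathrm{LO}}$ is its restriction to $\mathrm{LO}$. $\mathcal{L}$ is ccs (closed under convex sums) if for all $K,K'\in\mathcal{L}$ and every family $(K'_k)_{k\in K}$ of nonempty convex subsets of $K'$ such that $k_0<_K k_1\Rightarrow K'_{k_0}\le_{K'}K'_{k_1}$, we have $\sum_{k\in K}K'_k\in\mathcal{L}$, where $\sum_{k\in K}K'_k=\{(x,k): k\in K, x\in K'_k\}$ ordered antilexicographically. When $\mathcal{L}$ is ccs, $\trianglelefteq^{\mathcal{L}}$ is a quasi-order. A quasi-order $(X,\precsim)$ embeds into $(Y,\precsim')$ if there is $\varphi:X\to Y$ with $x\precsim x'\iff\varphi(x)\precsim'\varphi(x')$. -}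

module Defs where

open import Axiom.ExcludedMiddle using (ExcludedMiddle) public
open import Data.Bool using (Bool; T)
open import Data.Bool.Properties using (T-irrelevant; T?)
open import Data.List using (List)
open import Data.List.Membership.Propositional using () renaming (_∈_ to _∈ˡ_)
open import Data.Nat using (ℕ; _≟_)
open import Data.Product using (Σ; Σ-syntax; ∃; ∃-syntax; _×_; _,_; proj₁; proj₂; map₂)
open import Data.Product.Relation.Binary.Lex.NonStrict using (×-decTotalOrder)
open import Data.Rational.Properties using () renaming (≤-decTotalOrder to ℚ-≤)
open import Data.Sum using (_⊎_; inj₁; inj₂)
open import Function using (_⇔_)
open import Level using (Level; 0ℓ; _⊔_) renaming (suc to lsuc) public
open import Relation.Binary using (Rel; DecTotalOrder)
open import Relation.Binary.Morphism.Structures using (IsOrderIsomorphism)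
open import Relation.Binary.PropositionalEquality using (_≡_; refl; cong; isEquivalence)
import Relation.Binary.Construct.NonStrictToStrict as ToStrict
import Relation.Binary.Construct.On as On
open import Relation.Nullary using (¬_)
open import Relation.Nullary.Decidable using (map′)
open import Relation.Unary using (Pred; _∈_; _∪_; Satisfiable)

private
  variable
    a b ℓ ℓ₁ ℓ₂ : Level

IsEmbedding : {A : Set a} {B : Set b} → Rel A ℓ₁ → Rel B ℓ₂ → (A → B) → Set (a ⊔ ℓ₁ ⊔ ℓ₂)
IsEmbedding R S f = ∀ x y → R x y ⇔ S (f x) (f y)

_EmbedsInto_ : {A : Set a} {B : Set b} → Rel A ℓ₁ → Rel B ℓ₂ → Set (a ⊔ b ⊔ ℓ₁ ⊔ ℓ₂)
R EmbedsInto S = ∃[ φ ] IsEmbedding R S φ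

Order : Set₁
Order = DecTotalOrder 0ℓ 0ℓ 0ℓ

∣_∣ : Order → Set
∣_∣ = DecTotalOrder.Carrier

open DecTotalOrder using () renaming (_≤_ to le; _≈_ to eq)

lt : (L : Order) → Rel ∣ L ∣ 0ℓ
lt L = ToStrict._<_ (eq L) (le L)

_≼_ : Order → Order → Set
L ≼ L′ = le L EmbedsInto le L′

_≅_ : Order → Order → Set
L ≅ L′ = ∃[ f ] IsOrderIsomorphism (eq L) (eq L′) (le L) (le L′) f

Subset : Order → Set₁
Subset L = Pred ∣ L ∣ 0ℓ

-- In particular a convex set respects the equality of L.
Convex : (L : Order) → Subset L → Set
Convex L I = ∀ {x y z} → le L x y → le L y z → x ∈ I → z ∈ I → y ∈ I

Setwise : {A : Set} → Rel A 0ℓ → Pred A 0ℓ → Pred A 0ℓ → Set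
Setwise R A B = ∀ {x y} → x ∈ A → y ∈ B → R x y

image : (L L′ : Order) → (∣ L ∣ → ∣ L′ ∣) → Subset L → Subset L′
image L L′ f A y = ∃[ x ] x ∈ A × eq L′ (f x) y

record IsConvexPartition (K L : Order) (P : ∣ K ∣ → Subset L) : Set where
  field
    nonempty : ∀ k → Satisfiable (P k)
    cover    : ∀ x → ∃[ k ] x ∈ P k
    disjoint : ∀ {k k′ x} → x ∈ P k → x ∈ P k′ → eq K k k′
    ordered  : ∀ k k′ → lt K k k′ ⇔ Setwise (lt L) (P k) (P k′)

-- The library's lexicographic product compares first components first, so
-- with the index k as first component it is the antilexicographic order on
-- the pairs (x , k).
convexSum : (K K′ : Order) → (∣ K ∣ → Subset K′) → Order
convexSum K K′ S = On.decTotalOrder (×-decTotalOrder K K′) inclusion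
  where
  inclusion : (Σ[ k ∈ ∣ K ∣ ] Σ[ x ∈ ∣ K′ ∣ ] x ∈ S k) → ∣ K ∣ × ∣ K′ ∣
  inclusion (k , x , _) = k , x

-- Orders being reflexive, the domain of a code is read off its diagonal.
Code : Set
Code = ℕ → ℕ → Bool

Dom : Code → Set
Dom r = Σ[ n ∈ ℕ ] T (r n n)

record IsLinear (r : Code) : Set where
  field
    domˡ    : ∀ {m n} → T (r m n) → T (r m m)
    domʳ    : ∀ {m n} → T (r m n) → T (r n n)
    antisym : ∀ {m n} → T (r m n) → T (r n m) → m ≡ n
    trans   : ∀ {l m n} → T (r l m) → T (r m n) → T (r l n)
    total   : ∀ {m n} → T (r m m) → T (r n n) → T (r m n) ⊎ T (r n m)

IsFin : Pred Code 0ℓ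
IsFin r = IsLinear r × Dom r × (∃[ ns ] ∀ n → T (r n n) → n ∈ˡ ns)

IsLO : Pred Code 0ℓ
IsLO r = IsLinear r × (∀ n → T (r n n))

Lin : Set
Lin = ∃ (IsFin ∪ IsLO)

LO : Set
LO = ∃ IsLO

LO⇒Lin : LO → Lin
LO⇒Lin = map₂ inj₂

order : (r : Code) → IsLinear r → Order
order r lin = record
  { Carrier = Dom r
  ; _≈_     = _≡_
  ; _≤_     = λ x y → T (r (proj₁ x) (proj₁ y))
  ; isDecTotalOrder = record
    { isTotalOrder = record
      { isPartialOrder = record
        { isPreorder = record
          { isEquivalence = isEquivalence
          ; reflexive     = λ { {x} refl → proj₂ x }
          ; trans         = IsLinear.trans lin
          }
        ; antisym = λ p q → Dom-≡ (IsLinear.antisym lin p q)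
        }
      ; total = λ x y → IsLinear.total lin (proj₂ x) (proj₂ y)
      }
    ; _≟_  = λ x y → map′ Dom-≡ (cong proj₁) (proj₁ x ≟ proj₁ y)
    ; _≤?_ = λ x y → T? (r (proj₁ x) (proj₁ y))
    }
  }
  where
  Dom-≡ : {x y : Dom r} → proj₁ x ≡ proj₁ y → x ≡ y
  Dom-≡ {n , p} {.n , q} refl = cong (n ,_) (T-irrelevant p q)

⟦_⟧ : Lin → Order
⟦ r , inj₁ (lin , _) ⟧ = order r lin
⟦ r , inj₂ (lin , _) ⟧ = order r lin

Scat : Pred Lin 0ℓ
Scat L = ¬ (ℚ-≤ ≼ ⟦ L ⟧)

-- A downward closed class of codes is isomorphism invariant, so it determines
-- membership of any order, such as a convex sum, that is isomorphic to a code.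
_∈≅_ : Order → Pred Lin ℓ → Set ℓ
M ∈≅ 𝓛 = ∃[ K ] K ∈ 𝓛 × ⟦ K ⟧ ≅ M

DownwardClosed : Pred Lin ℓ → Set ℓ
DownwardClosed 𝓛 = ∀ (K L : Lin) → ⟦ K ⟧ ≼ ⟦ L ⟧ → L ∈ 𝓛 → K ∈ 𝓛

CCS : Pred Lin ℓ → Set (lsuc 0ℓ ⊔ ℓ)
CCS 𝓛 = ∀ (K K′ : Lin) → K ∈ 𝓛 → K′ ∈ 𝓛 →
        (S : ∣ ⟦ K ⟧ ∣ → Subset ⟦ K′ ⟧) →
        (∀ k → Satisfiable (S k)) →
        (∀ k → Convex ⟦ K′ ⟧ (S k)) →
        (∀ k₀ k₁ → lt ⟦ K ⟧ k₀ k₁ → Setwise (le ⟦ K′ ⟧) (S k₀) (S k₁)) →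
        convexSum ⟦ K ⟧ ⟦ K′ ⟧ S ∈≅ 𝓛

_⊴[_]_ : Order → Pred Lin ℓ → Order → Set (lsuc 0ℓ ⊔ ℓ)
L ⊴[ 𝓛 ] L′ =
  ∃[ K ] K ∈ 𝓛 ×
  (Σ[ P ∈ (∣ ⟦ K ⟧ ∣ → Subset L) ] IsConvexPartition ⟦ K ⟧ L P ×
  (Σ[ f ∈ (∣ L ∣ → ∣ L′ ∣) ] IsEmbedding (le L) (le L′) f ×
  (∀ k → Convex L′ (image L L′ f (P k)))))

⊴LO : Pred Lin ℓ → Rel LO (lsuc 0ℓ ⊔ ℓ)
⊴LO 𝓛 L L′ = ⟦ LO⇒Lin L ⟧ ⊴[ 𝓛 ] ⟦ LO⇒Lin L′ ⟧

UpperCone : Pred Lin ℓ → LO → Set (lsuc 0ℓ ⊔ ℓ)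
UpperCone 𝓛 L₀ = Σ[ L ∈ LO ] ⊴LO 𝓛 L₀ L

⊴Cone : (𝓛 : Pred Lin ℓ) (L₀ : LO) → Rel (UpperCone 𝓛 L₀) (lsuc 0ℓ ⊔ ℓ)
⊴Cone 𝓛 L₀ (L , _) (L′ , _) = ⊴LO 𝓛 L L′

{-# OPTIONS --safe #-}
module Submission where

-- Write B for L₀. The embedding is
--
--   φ(L) = Σ_{l ∈ L} (B + H₀ + H₁),    H_t = Σ_{d ∈ D} (a block of size t d + 1 points),
--
-- where D = Σ_{ℚ} Σ_{B} Σ_{B} ℚ is dense without endpoints and `size` takes
-- different values at different pairs (t , d). As D has no endpoints and no
-- jumps, the blocks are maximal sets of finitely many consecutive points, so a
-- block is recognised by its cardinality alone. Each copy of B is convex in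
-- φ(L), which puts φ(L) into the upper cone of L₀ (`inCone`).
--
-- It is convenient to describe L ⊴ L′ by a monotone map κ from L to some K in
-- the class and an embedding f of L that maps the fibres of κ onto convex sets
-- (`⊴⇒fibres`, `fibres⇒⊴`; the second one uses downward closure to replace K by
-- the range of κ). In this form it is clear that φ preserves ⊴ (`preserve`).
--
-- For the converse, restrict f : φ(L) → φ(L′) to a piece. This is an isomorphism
-- R between convex parts of the two orders, and both R and its inverse preserve
-- maximal finite blocks (`block-transfer`). The lemma `matching` says that in
-- every interval of H_t that lies inside a single copy and within the domain of
-- R, and whose ends have indices with different leading rationals, some block d
-- is mapped to a block of φ(L′) outside the copies of B, hence to the block with
-- the same t and d. Otherwise R would map an interval into a single copy of B,
-- as different copies of B are separated by further blocks; let two of its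
-- points go to x < x′. The values of `size` diagonalise against this: an
-- index d carries a target (x , x′), and the parity of size t d is chosen so that
-- the blocks of B between x and x′ differ from the blocks of any interval of H_t
-- containing d (`size-diagonal`). As only the leading rationals of D need to be
-- compared, every target occurs between any two of them.
--
-- Since K is scattered, two indices of H_t with different leading rationals
-- share a piece, in each copy l (`collapse`). By `matching` there are an index d
-- and h_t(l) in L′ such that f maps the block d of H_t in copy l to the block d
-- of H_t in copy h_t(l) (`fixed`). If l < m, the block in H₁ of copy l and the
-- block in H₀ of copy m keep their order under f, whereas H₀ is below H₁; hence
-- h₁(l) < h₀(m) ≤ h₁(m), so h₁ is an embedding of L into L′. Its pieces are
-- given by the piece of φ(L) that contains the chosen block of H₁. If n lies
-- strictly between two values of h₁ on one piece, then the whole copy n lies in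
-- the range of R. Applying `matching` to the inverse of R, and once more to R,
-- one finds a copy l with blocks on both sides of its chosen block that are
-- mapped into copy n, so n = h₁(l) and l belongs to the same piece (`onto`).

open import Defs
open import Data.Bool using (T)
open import Data.Empty using (⊥-elim)
open import Data.Fin using (Fin; zero; suc; toℕ; fromℕ; inject₁)
import Data.Fin.Properties as Fin
open import Data.Fin.Relation.Unary.Top using (view; ‵fromℕ; ‵inj₁)
open import Data.Integer as ℤ using (ℤ)
open import Data.List using (upTo)
open import Data.List.Membership.Propositional.Properties using (∈-upTo⁺)
open import Data.Nat as ℕ using (ℕ; zero; suc; _≤_; _<_; z≤n; s≤s)
import Data.Nat.Properties as ℕ
open import Data.Product using (Σ; Σ-syntax; ∃-syntax; _×_; _,_; proj₁; proj₂)
open import Data.Rational as ℚ using (ℚ; mkℚ)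
import Data.Rational.Properties as ℚ
open import Data.Sum using (_⊎_; inj₁; inj₂; [_,_]′)
open import Function using (_∘_; mk⇔; _↣_; mk↣; Injection; Equivalence)
open import Level using (Lift; lift; lower)
open import Relation.Binary using (DecTotalOrder; IsStrictTotalOrder; Tri; tri<; tri≈; tri>)
import Relation.Binary.Construct.On as On
import Relation.Binary.Construct.NonStrictToStrict as ToStrict
import Relation.Binary.Construct.StrictToNonStrict as ToNonStrict
open import Relation.Binary.PropositionalEquality
  using (_≡_; _≢_; refl; sym; trans; cong; subst; subst₂; isEquivalence; resp₂)
open import Relation.Nullary using (¬_; Dec; yes; no; contradiction)
open import Relation.Nullary.Decidable using (map′; ⌊_⌋; toWitness; fromWitness)
open import Relation.Unary using (Pred; _∈_; _⊆_; Satisfiable)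

open DecTotalOrder using () renaming (_≤_ to le; _≈_ to eq)
open Equivalence using (to; from)

-- Countable types

double : ℕ → ℕ
double zero    = zero
double (suc n) = suc (suc (double n))

double-injective : ∀ m n → double m ≡ double n → m ≡ n
double-injective zero    zero    _ = refl
double-injective (suc m) (suc n) p =
  cong suc (double-injective m n (ℕ.suc-injective (ℕ.suc-injective p)))

double≢1+double : ∀ m n → double m ≢ suc (double n)
double≢1+double (suc m) (suc n) p =
  double≢1+double m n (ℕ.suc-injective (ℕ.suc-injective p))

n≤double : ∀ n → n ≤ double n
n≤double zero    = z≤n
n≤double (suc n) = s≤s (ℕ.m≤n⇒m≤1+n (n≤double n))

-- The pairing function 2ᵃ(2b + 1).
pair : ℕ → ℕ → ℕ
pair zero    b = suc (double b)
pair (suc a) b = double (pair a b)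

pair-injective : ∀ a b a′ b′ → pair a b ≡ pair a′ b′ → a ≡ a′ × b ≡ b′
pair-injective zero    b zero     b′ p = refl , double-injective b b′ (ℕ.suc-injective p)
pair-injective zero    b (suc a′) b′ p = contradiction (sym p) (double≢1+double (pair a′ b′) b)
pair-injective (suc a) b zero     b′ p = contradiction p (double≢1+double (pair a b) b′)
pair-injective (suc a) b (suc a′) b′ p
  with refl , refl ← pair-injective a b a′ b′ (double-injective _ _ p) = refl , refl

a<pair : ∀ a b → a < pair a b
a<pair zero    b = s≤s z≤n
a<pair (suc a) b with pair a b | a<pair a b
... | suc p | s≤s a≤p = s≤s (s≤s (ℕ.≤-trans a≤p (n≤double p)))

Σ-countable : {I : Set} {F : I → Set} → I ↣ ℕ → (∀ i → F i ↣ ℕ) → Σ I F ↣ ℕ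
Σ-countable {I} {F} cI cF = mk↣ {to = code} injective
  where
  open Injection using () renaming (to to app; injective to inj)

  code : Σ I F → ℕ
  code (i , x) = pair (app cI i) (app (cF i) x)

  injective : ∀ {u v} → code u ≡ code v → u ≡ v
  injective {i , x} {j , y} p with q , r ← pair-injective (app cI i) _ (app cI j) _ p
    with refl ← inj cI q = cong (i ,_) (inj (cF i) r)

Fin-countable : ∀ n → Fin n ↣ ℕ
Fin-countable n = mk↣ Fin.toℕ-injective

ℤ-countable : ℤ ↣ ℕ
ℤ-countable = mk↣ {to = code} injective
  where
  code : ℤ → ℕ
  code (ℤ.+ n)    = double n
  code ℤ.-[1+ n ] = suc (double n)

  injective : ∀ {i j} → code i ≡ code j → i ≡ j
  injective {ℤ.+ m}     {ℤ.+ n}     p = cong ℤ.+_ (double-injective m n p)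
  injective {ℤ.+ m}     {ℤ.-[1+ n ]} p = contradiction p (double≢1+double m n)
  injective {ℤ.-[1+ m ]} {ℤ.+ n}     p = contradiction (sym p) (double≢1+double n m)
  injective {ℤ.-[1+ m ]} {ℤ.-[1+ n ]} p =
    cong ℤ.-[1+_] (double-injective m n (ℕ.suc-injective p))

ℚ-countable : ℚ ↣ ℕ
ℚ-countable = mk↣ {to = code} injective
  where
  open Injection ℤ-countable using () renaming (to to codeℤ; injective to injℤ)

  code : ℚ → ℕ
  code (mkℚ n d _) = pair (codeℤ n) d

  injective : ∀ {p q} → code p ≡ code q → p ≡ q
  injective {mkℚ n d _} {mkℚ n′ d′ _} p
    with q , refl ← pair-injective (codeℤ n) d (codeℤ n′) d′ p
    with refl ← injℤ {n} {n′} q = refl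

-- Ranks in a set of natural numbers

module Rank (U : ℕ → Set) (U? : ∀ n → Dec (U n)) where

  -- The number of elements of U below n.
  rank : ℕ → ℕ
  rank zero    = zero
  rank (suc n) with U? n
  ... | yes _ = suc (rank n)
  ... | no  _ = rank n

  rank-suc : ∀ {n} → U n → rank (suc n) ≡ suc (rank n)
  rank-suc {n} u with U? n
  ... | yes _ = refl
  ... | no ¬u = contradiction u ¬u

  rank-≤suc : ∀ n → rank n ≤ rank (suc n)
  rank-≤suc n with U? n
  ... | yes _ = ℕ.n≤1+n _
  ... | no  _ = ℕ.≤-refl

  rank-mono : ∀ {m n} → m ≤ n → rank m ≤ rank n
  rank-mono {m} m≤n = go (ℕ.≤⇒≤′ m≤n)
    where
    go : ∀ {n} → m ℕ.≤′ n → rank m ≤ rank n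
    go ℕ.≤′-refl     = ℕ.≤-refl
    go (ℕ.≤′-step p) = ℕ.≤-trans (go p) (rank-≤suc _)

  rank-< : ∀ {m n} → U m → m < n → rank m < rank n
  rank-< u m<n = subst (_≤ _) (rank-suc u) (rank-mono m<n)

  rank-injective : ∀ {m n} → U m → U n → rank m ≡ rank n → m ≡ n
  rank-injective {m} {n} um un p with ℕ.<-cmp m n
  ... | tri< m<n _ _ = contradiction p (ℕ.<⇒≢ (rank-< um m<n))
  ... | tri≈ _ m≡n _ = m≡n
  ... | tri> _ _ n<m = contradiction (sym p) (ℕ.<⇒≢ (rank-< un n<m))

  rank-attained : ∀ k n → k < rank n → ∃[ m ] U m × rank m ≡ k
  rank-attained k (suc n) k<r with U? n
  ... | no  _ = rank-attained k n k<r
  ... | yes u with ℕ.m≤n⇒m<n∨m≡n (ℕ.s≤s⁻¹ k<r)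
  ...   | inj₁ k<r′ = rank-attained k n k<r′
  ...   | inj₂ k≡r′ = n , u , sym k≡r′

  module _ (unbounded : ∀ n → ∃[ m ] n ≤ m × U m) where

    rank-unbounded : ∀ k → ∃[ n ] k ≤ rank n
    rank-unbounded zero = zero , z≤n
    rank-unbounded (suc k) with rank-unbounded k
    ... | n , k≤ with unbounded n
    ...   | m , n≤m , u = suc m ,
      subst (suc k ≤_) (sym (rank-suc u)) (s≤s (ℕ.≤-trans k≤ (rank-mono n≤m)))

    rank-surjective : ∀ k → ∃[ m ] U m × rank m ≡ k
    rank-surjective k with rank-unbounded (suc k)
    ... | n , k<r = rank-attained k n k<r

-- Codes of countable orders

-- Isomorphisms, as surjective embeddings.
record _≃_ (L M : Order) : Set where
  field
    fwd  : ∣ L ∣ → ∣ M ∣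
    emb  : IsEmbedding (le L) (le M) fwd
    surj : ∀ y → ∃[ x ] eq M (fwd x) y

  bwd : ∣ M ∣ → ∣ L ∣
  bwd = proj₁ ∘ surj

  fwd-bwd : ∀ y → eq M (fwd (bwd y)) y
  fwd-bwd = proj₂ ∘ surj

  fwd-cong : ∀ {x y} → eq L x y → eq M (fwd x) (fwd y)
  fwd-cong {x} {y} p = M.antisym
    (to (emb x y) (L.reflexive p)) (to (emb y x) (L.reflexive (L.Eq.sym p)))
    where
    module L = DecTotalOrder L
    module M = DecTotalOrder M

≃-sym : ∀ {L M} → L ≃ M → M ≃ L
≃-sym {L} {M} i = record { fwd = bwd ; emb = emb′ ; surj = surj′ }
  where
  open _≃_ i
  module L = DecTotalOrder L
  module M = DecTotalOrder M

  emb′ : IsEmbedding (le M) (le L) bwd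
  emb′ x y = mk⇔
    (λ p → from (emb _ _) (M.trans (M.reflexive (fwd-bwd x))
             (M.trans p (M.reflexive (M.Eq.sym (fwd-bwd y))))))
    (λ p → M.trans (M.reflexive (M.Eq.sym (fwd-bwd x)))
             (M.trans (to (emb _ _) p) (M.reflexive (fwd-bwd y))))

  surj′ : ∀ x → ∃[ y ] eq L (bwd y) x
  surj′ x = fwd x , L.antisym
    (from (emb _ _) (M.reflexive (fwd-bwd (fwd x))))
    (from (emb _ _) (M.reflexive (M.Eq.sym (fwd-bwd (fwd x)))))

-- A numbering of an order: two points have the same number if and only if they
-- are equal in the order.
record Numbering (X : Order) : Set where
  field
    num       : ∣ X ∣ → ℕ
    num-cong  : ∀ {x y} → eq X x y → num x ≡ num y
    injective : ∀ {x y} → num x ≡ num y → eq X x y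

-- The order that X induces on the numbers of its points, as a code. Excluded
-- middle makes it Boolean-valued.
module Encode (em : ExcludedMiddle 0ℓ) (X : Order) (ν : Numbering X) where
  open DecTotalOrder X using (reflexive; antisym; total; module Eq)
    renaming (trans to ≤-trans; refl to ≤-refl)
  open Numbering ν

  -- m and n are the numbers of points that are related in X.
  Rep : ℕ → ℕ → Set
  Rep m n = ∃[ x ] ∃[ y ] num x ≡ m × num y ≡ n × le X x y

  code : Code
  code m n = ⌊ em {Rep m n} ⌋

  private
    decode : ∀ {m n} → T (code m n) → Rep m n
    decode {m} {n} = toWitness {a? = em {Rep m n}}

    encode : ∀ {m n} → Rep m n → T (code m n)
    encode {m} {n} = fromWitness {a? = em {Rep m n}}

    same : ∀ {x y n} → num x ≡ n → num y ≡ n → le X x y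
    same p q = reflexive (injective (trans p (sym q)))

  linear : IsLinear code
  linear = record
    { domˡ    = λ t → let x , _ , p , _ = decode t in encode (x , x , p , p , ≤-refl)
    ; domʳ    = λ t → let _ , y , _ , q , _ = decode t in encode (y , y , q , q , ≤-refl)
    ; antisym = λ s t →
        let x  , y  , p  , q  , x≤y   = decode s
            y′ , x′ , q′ , p′ , y′≤x′ = decode t
        in trans (sym p) (trans (num-cong (antisym x≤y
             (≤-trans (same q q′) (≤-trans y′≤x′ (same p′ p))))) q)
    ; trans   = λ s t →
        let x  , y , p  , q , x≤y  = decode s
            y′ , z , q′ , r , y′≤z = decode t
        in encode (x , z , p , r , ≤-trans x≤y (≤-trans (same q q′) y′≤z))
    ; total   = λ s t →
        let x , _ , p , _ = decode s
            y , _ , q , _ = decode t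
        in [ (λ x≤y → inj₁ (encode (x , y , p , q , x≤y)))
           , (λ y≤x → inj₂ (encode (y , x , q , p , y≤x))) ]′ (total x y)
    }

  iso : order code linear ≃ X
  iso = record { fwd = fwd ; emb = emb ; surj = surj }
    where
    fwd : Dom code → ∣ X ∣
    fwd (_ , t) = proj₁ (decode t)

    num-fwd : ∀ m → num (fwd m) ≡ proj₁ m
    num-fwd (_ , t) = proj₁ (proj₂ (proj₂ (decode t)))

    emb : IsEmbedding (le (order code linear)) (le X) fwd
    emb m n = mk⇔
      (λ t → let x , y , p , q , x≤y = decode t in
         ≤-trans (same (num-fwd m) p) (≤-trans x≤y (same q (num-fwd n))))
      (λ p → encode (fwd m , fwd n , num-fwd m , num-fwd n , p))

    surj : ∀ y → ∃[ m ] eq X (fwd m) y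
    surj y = (num y , encode (y , y , refl , refl , ≤-refl)) ,
             injective (num-fwd (num y , encode (y , y , refl , refl , ≤-refl)))

  isLO : (∀ n → ∃[ x ] num x ≡ n) → IsLO code
  isLO onto = linear , λ n → let x , p = onto n in encode (x , x , p , p , ≤-refl)

  isFin : ∣ X ∣ → ∀ b → (∀ x → num x < b) → IsFin code
  isFin x b bounded = linear , (num x , encode (x , x , refl , refl , ≤-refl)) ,
    upTo b , λ n t → let y , _ , p , _ = decode t in ∈-upTo⁺ (subst (_< b) p (bounded y))

module _ (em : ExcludedMiddle 0ℓ) {X : Order} (ν : Numbering X) where
  open Numbering ν

  private
    open Rank (λ n → ∃[ x ] num x ≡ n) (λ _ → em)

    -- Replacing numbers by their ranks makes the numbering of an infinite
    -- order surjective.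
    ν′ : Numbering X
    ν′ = record
      { num       = rank ∘ num
      ; num-cong  = cong rank ∘ num-cong
      ; injective = λ p → injective (rank-injective (_ , refl) (_ , refl) p)
      }

  -- If the numbers are unbounded, the order has a code with domain all of ℕ.
  toLO : (∀ n → ∃[ x ] n ≤ num x) → Σ[ L ∈ LO ] ⟦ LO⇒Lin L ⟧ ≃ X
  toLO unbounded = (code , isLO onto) , iso
    where
    open Encode em X ν′
    onto : ∀ k → ∃[ x ] rank (num x) ≡ k
    onto k with rank-surjective (λ n → let x , p = unbounded n in num x , p , x , refl) k
    ... | _ , (x , refl) , q = x , q

  toLin : ∣ X ∣ → Σ[ L ∈ Lin ] ⟦ L ⟧ ≃ X
  toLin x₀ with em {∃[ b ] ∀ x → num x < b}
  ... | yes (b , p) = let open Encode em X ν in (code , inj₁ (isFin x₀ b p)) , iso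
  ... | no ¬bounded = let L , i = toLO unbounded in LO⇒Lin L , i
    where
    unbounded : ∀ n → ∃[ x ] n ≤ num x
    unbounded n with em {∃[ x ] n ≤ num x}
    ... | yes p = p
    ... | no ¬p = contradiction (n , λ x → ℕ.≰⇒> (λ q → ¬p (x , q))) ¬bounded

-- Piecewise convex embeddings as monotone maps

⟦⟧-≡ : ∀ K {x y} → eq ⟦ K ⟧ x y → x ≡ y
⟦⟧-≡ (_ , inj₁ _) p = p
⟦⟧-≡ (_ , inj₂ _) p = p

order-numbering : ∀ r lin → Numbering (order r lin)
order-numbering r lin = record
  { num       = proj₁
  ; num-cong  = cong proj₁
  ; injective = λ { {m , s} {.m , t} refl →
      DecTotalOrder.antisym (order r lin) {m , s} {m , t} s s }
  }

⟦⟧-numbering : ∀ K → Numbering ⟦ K ⟧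
⟦⟧-numbering (r , inj₁ (lin , _)) = order-numbering r lin
⟦⟧-numbering (r , inj₂ (lin , _)) = order-numbering r lin

⟦⟧-point : ∀ K → ∣ ⟦ K ⟧ ∣
⟦⟧-point (_ , inj₁ (_ , x , _)) = x
⟦⟧-point (_ , inj₂ (_ , all))   = 0 , all 0

-- L ⊴ L′ through a monotone map κ into K: the pieces are the nonempty fibres of
-- κ, and f-convex says that f maps each of them onto a convex set.
record _⊴⟨_⟩_ (L K L′ : Order) : Set where
  field
    κ        : ∣ L ∣ → ∣ K ∣
    κ-mono   : ∀ {x y} → le L x y → le K (κ x) (κ y)
    f        : ∣ L ∣ → ∣ L′ ∣
    f-emb    : IsEmbedding (le L) (le L′) f
    f-convex : ∀ {x z w} → eq K (κ x) (κ z) → le L′ (f x) w → le L′ w (f z) →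
               ∃[ y ] eq K (κ x) (κ y) × eq L′ (f y) w

⊴⇒fibres : ∀ {ℓ} (𝓛 : Pred Lin ℓ) {L L′} → L ⊴[ 𝓛 ] L′ → ∃[ K ] K ∈ 𝓛 × L ⊴⟨ ⟦ K ⟧ ⟩ L′
⊴⇒fibres 𝓛 {L} {L′} (K , K∈𝓛 , P , part , f , f-emb , conv) = K , K∈𝓛 , record
  { κ        = κ
  ; κ-mono   = κ-mono
  ; f        = f
  ; f-emb    = f-emb
  ; f-convex = λ {x} {z} {w} p fx≤w w≤fz →
      let y , y∈P , q = conv (κ x) fx≤w w≤fz (x , x∈P x , L′.Eq.refl)
            (z , subst (λ k → P k z) (sym (⟦⟧-≡ K p)) (x∈P z) , L′.Eq.refl)
      in y , disjoint y∈P (x∈P y) , q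
  }
  where
  open IsConvexPartition part
  module L  = DecTotalOrder L
  module L′ = DecTotalOrder L′
  module K  = DecTotalOrder ⟦ K ⟧

  κ : ∣ L ∣ → ∣ ⟦ K ⟧ ∣
  κ = proj₁ ∘ cover

  x∈P : ∀ x → x ∈ P (κ x)
  x∈P = proj₂ ∘ cover

  κ-mono : ∀ {x y} → le L x y → le ⟦ K ⟧ (κ x) (κ y)
  κ-mono {x} {y} x≤y with K.total (κ x) (κ y)
  ... | inj₁ p = p
  ... | inj₂ p with κ y K.≟ κ x
  ...   | yes q = K.reflexive (K.Eq.sym q)
  ...   | no ¬q with y≤x , y≉x ← to (ordered (κ y) (κ x)) (p , ¬q) (x∈P y) (x∈P x) =
    contradiction (L.antisym y≤x x≤y) y≉x

fibres⇒⊴ : ∀ {ℓ} → ExcludedMiddle 0ℓ → (𝓛 : Pred Lin ℓ) → DownwardClosed 𝓛 →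
           ∀ K → K ∈ 𝓛 → ∀ {L L′} → ∣ L ∣ → L ⊴⟨ ⟦ K ⟧ ⟩ L′ → L ⊴[ 𝓛 ] L′
fibres⇒⊴ em 𝓛 down K K∈𝓛 {L} {L′} x₀ r =
  K′ , down K′ K (κ ∘ fwd , emb) K∈𝓛 , P , part , f , f-emb , conv
  where
  open _⊴⟨_⟩_ r
  module L  = DecTotalOrder L
  module L′ = DecTotalOrder L′
  module K  = DecTotalOrder ⟦ K ⟧

  -- The range of κ, presented as L with two points identified when they lie in
  -- the same fibre.
  Q : Order
  Q = On.decTotalOrder ⟦ K ⟧ κ

  ν : Numbering Q
  ν = let open Numbering (⟦⟧-numbering K) in
      record { num = num ∘ κ ; num-cong = num-cong ; injective = injective }

  K′ : Lin
  K′ = proj₁ (toLin em ν x₀)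

  open _≃_ (proj₂ (toLin em ν x₀)) using (fwd; emb; surj; fwd-cong)
  module K′ = DecTotalOrder ⟦ K′ ⟧

  -- The fibres of κ, indexed by K′.
  P : ∣ ⟦ K′ ⟧ ∣ → Subset L
  P k x = eq ⟦ K ⟧ (κ (fwd k)) (κ x)

  part : IsConvexPartition ⟦ K′ ⟧ L P
  part = record
    { nonempty = λ k → fwd k , K.Eq.refl
    ; cover    = surj
    ; disjoint = λ p q → let e = K.Eq.trans p (K.Eq.sym q) in
        K′.antisym (from (emb _ _) (K.reflexive e)) (from (emb _ _) (K.reflexive (K.Eq.sym e)))
    ; ordered  = λ k k′ → mk⇔ (λ (p , q) → separated p q) reflected
    }
    where
    to′ : ∀ {k k′} → le ⟦ K ⟧ (κ (fwd k)) (κ (fwd k′)) → le ⟦ K′ ⟧ k k′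
    to′ = from (emb _ _)

    reflected : ∀ {k k′} → Setwise (lt L) (P k) (P k′) → lt ⟦ K′ ⟧ k k′
    reflected {k} {k′} s = to′ (κ-mono (proj₁ (s {fwd k} {fwd k′} K.Eq.refl K.Eq.refl))) ,
      λ k≈k′ → proj₂ (s {fwd k} {fwd k} K.Eq.refl (K.Eq.sym (κ-cong k≈k′))) L.Eq.refl
      where
      κ-cong : eq ⟦ K′ ⟧ k k′ → eq ⟦ K ⟧ (κ (fwd k)) (κ (fwd k′))
      κ-cong = fwd-cong

    separated : ∀ {k k′} → le ⟦ K′ ⟧ k k′ → ¬ eq ⟦ K′ ⟧ k k′ →
                ∀ {x y} → x ∈ P k → y ∈ P k′ → lt L x y
    separated {k} {k′} k≤k′ k≉k′ {x} {y} p q =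
      [ (λ x≤y → x≤y) , (λ y≤x → ⊥-elim (¬y≤x y≤x)) ]′ (L.total x y) ,
      λ x≈y → ¬y≤x (L.reflexive (L.Eq.sym x≈y))
      where
      ¬y≤x : ¬ le L y x
      ¬y≤x y≤x = k≉k′ (K′.antisym k≤k′ (to′
        (K.trans (K.reflexive q) (K.trans (κ-mono y≤x) (K.reflexive (K.Eq.sym p))))))

  conv : ∀ k → Convex L′ (image L L′ f (P k))
  conv k x≤y y≤z (a , p , fa≈x) (b , q , fb≈z)
    with c , s , t ← f-convex (K.Eq.trans (K.Eq.sym p) q)
           (L′.trans (L′.reflexive fa≈x) x≤y) (L′.trans y≤z (L′.reflexive (L′.Eq.sym fb≈z)))
    = c , K.Eq.trans p s , t

⊴⟨⟩-resp-≃ : ∀ {K L M L′ M′} → M ≃ L → L′ ≃ M′ → L ⊴⟨ K ⟩ L′ → M ⊴⟨ K ⟩ M′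
⊴⟨⟩-resp-≃ {K} {L} {M} {L′} {M′} i j r = record
  { κ        = κ ∘ i.fwd
  ; κ-mono   = κ-mono ∘ to (i.emb _ _)
  ; f        = j.fwd ∘ f ∘ i.fwd
  ; f-emb    = λ x y → mk⇔
      (to (j.emb _ _) ∘ to (f-emb _ _) ∘ to (i.emb x y))
      (from (i.emb x y) ∘ from (f-emb _ _) ∘ from (j.emb _ _))
  ; f-convex = f-convex′
  }
  where
  open _⊴⟨_⟩_ r
  module i = _≃_ i
  module j = _≃_ j
  module K  = DecTotalOrder K
  module L  = DecTotalOrder L
  module L′ = DecTotalOrder L′
  module M′ = DecTotalOrder M′

  f-cong : ∀ {x y} → eq L x y → eq L′ (f x) (f y)
  f-cong p = L′.antisym (to (f-emb _ _) (L.reflexive p)) (to (f-emb _ _) (L.reflexive (L.Eq.sym p)))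

  f-convex′ : ∀ {x z w} → eq K (κ (i.fwd x)) (κ (i.fwd z)) →
              le M′ (j.fwd (f (i.fwd x))) w → le M′ w (j.fwd (f (i.fwd z))) →
              ∃[ y ] eq K (κ (i.fwd x)) (κ (i.fwd y)) × eq M′ (j.fwd (f (i.fwd y))) w
  f-convex′ {w = w} p u v
    with y , q , fy≈w′ ← f-convex {w = j.bwd w} p
           (from (j.emb _ _) (M′.trans u (M′.reflexive (M′.Eq.sym (j.fwd-bwd w)))))
           (from (j.emb _ _) (M′.trans (M′.reflexive (j.fwd-bwd w)) v))
    = i.bwd y
    , K.Eq.trans q (K.antisym (κ-mono (L.reflexive (L.Eq.sym (i.fwd-bwd y))))
                              (κ-mono (L.reflexive (i.fwd-bwd y))))
    , M′.Eq.trans (j.fwd-cong (L′.Eq.trans (f-cong (i.fwd-bwd y)) fy≈w′)) (j.fwd-bwd w)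

-- Chains and lexicographic sums

-- Linear orders given by their strict order, with propositional equality.
record Chain : Set₁ where
  infix 4 _<ᶜ_
  field
    Carrier : Set
    _<ᶜ_    : Carrier → Carrier → Set
    isSTO   : IsStrictTotalOrder _≡_ _<ᶜ_
  open IsStrictTotalOrder isSTO public using (compare; irrefl; asym)
    renaming (trans to <-trans)

open Chain using (Carrier; isSTO)

infix 4 less
syntax less C x y = x <[ C ] y

less : (C : Chain) → Carrier C → Carrier C → Set
less = Chain._<ᶜ_

-- The reflexive order of a chain, and the strict order of a code.
toOrder : Chain → Order
toOrder C = record { isDecTotalOrder = ToNonStrict.isDecTotalOrder _≡_ (less C) (isSTO C) }

ofLO : LO → Chain
ofLO L = record
  { isSTO = ToStrict.<-isStrictTotalOrder₂ _ _ (DecTotalOrder.isDecTotalOrder ⟦ LO⇒Lin L ⟧) }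

module _ (I : Chain) (F : Carrier I → Chain) where

  private
    module I = Chain I
    module F {i} = Chain (F i)

  data LexLess : Σ (Carrier I) (Carrier ∘ F) → Σ (Carrier I) (Carrier ∘ F) → Set where
    base  : ∀ {i j x y} → i <[ I ] j → LexLess (i , x) (j , y)
    fibre : ∀ {i x y} → x <[ F i ] y → LexLess (i , x) (i , y)

  -- The sum of the chains F i along the chain I.
  lexSum : Chain
  lexSum = record { _<ᶜ_ = LexLess ; isSTO = record
    { isStrictPartialOrder = record
      { isEquivalence = isEquivalence
      ; irrefl        = λ { refl p → irr p }
      ; trans         = tr
      ; <-resp-≈      = resp₂ _
      }
    ; compare = cmp
    } }
    where
    irr : ∀ {u} → ¬ LexLess u u
    irr (base p)  = I.irrefl refl p
    irr (fibre p) = F.irrefl refl p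

    tr : ∀ {u v w} → LexLess u v → LexLess v w → LexLess u w
    tr (base p)  (base q)  = base (I.<-trans p q)
    tr (base p)  (fibre q) = base p
    tr (fibre p) (base q)  = base q
    tr (fibre p) (fibre q) = fibre (F.<-trans p q)

    below : ∀ {u v} → LexLess u v → Tri (LexLess u v) (u ≡ v) (LexLess v u)
    below p = tri< p (λ { refl → irr p }) (λ q → irr (tr p q))

    above : ∀ {u v} → LexLess v u → Tri (LexLess u v) (u ≡ v) (LexLess v u)
    above p = tri> (λ q → irr (tr p q)) (λ { refl → irr p }) p

    cmp : ∀ u v → Tri (LexLess u v) (u ≡ v) (LexLess v u)
    cmp (i , x) (j , y) with I.compare i j
    ... | tri< p _ _ = below (base p)
    ... | tri> _ _ p = above (base p)
    ... | tri≈ _ refl _ with F.compare x y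
    ...   | tri< p _ _    = below (fibre p)
    ...   | tri> _ _ p    = above (fibre p)
    ...   | tri≈ _ refl _ = tri≈ irr refl irr

module _ {I : Chain} {F : Carrier I → Chain} where

  lex-cancel : ∀ {i x y} → LexLess I F (i , x) (i , y) → x <[ F i ] y
  lex-cancel (base p)  = contradiction p (Chain.irrefl I refl)
  lex-cancel (fibre p) = p

  lex-between : ∀ {i x y u} → LexLess I F (i , x) u → LexLess I F u (i , y) →
    ∃[ w ] u ≡ (i , w) × x <[ F i ] w × w <[ F i ] y
  lex-between (fibre p) q        = _ , refl , p , lex-cancel q
  lex-between (base p) (base q)  = contradiction q (Chain.asym I p)
  lex-between (base p) (fibre q) = contradiction p (Chain.irrefl I refl)

finChain : ℕ → Chain
finChain n = record { isSTO = Fin.<-isStrictTotalOrder {n} }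

ℚChain : Chain
ℚChain = record { isSTO = ℚ.<-isStrictTotalOrder }

-- Dense and without endpoints.
record DenseUnbounded (C : Chain) : Set where
  field
    dense : ∀ {x y} → x <[ C ] y → ∃[ z ] x <[ C ] z × z <[ C ] y
    above : ∀ x → ∃[ y ] x <[ C ] y
    below : ∀ x → ∃[ y ] y <[ C ] x

ℚ-denseUnbounded : DenseUnbounded ℚChain
ℚ-denseUnbounded = record
  { dense = ℚ.<-dense
  ; above = λ q → q ℚ.+ ℚ.1ℚ ,
      subst (ℚ._< q ℚ.+ ℚ.1ℚ) (ℚ.+-identityʳ q) (ℚ.+-monoʳ-< q (ℚ.*<* (ℤ.+<+ (s≤s z≤n))))
  ; below = λ q → q ℚ.- ℚ.1ℚ ,
      subst (q ℚ.- ℚ.1ℚ ℚ.<_) (ℚ.+-identityʳ q) (ℚ.+-monoʳ-< q (ℚ.*<* ℤ.-<+))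
  }

lexSum-denseUnbounded : ∀ I {C} → DenseUnbounded C → DenseUnbounded (lexSum I (λ _ → C))
lexSum-denseUnbounded I {C} d = record { dense = dense′ ; above = above′ ; below = below′ }
  where
  open DenseUnbounded d
  S = lexSum I (λ _ → C)

  above′ : ∀ u → ∃[ v ] u <[ S ] v
  above′ (i , x) = let y , p = above x in (i , y) , fibre p

  below′ : ∀ u → ∃[ v ] v <[ S ] u
  below′ (i , x) = let y , p = below x in (i , y) , fibre p

  dense′ : ∀ {u v} → u <[ S ] v → ∃[ w ] u <[ S ] w × w <[ S ] v
  dense′ {i , x} (base p)  = let y , q = above x in (i , y) , fibre q , base p
  dense′ {i , x} (fibre p) = let y , q , r = dense p in (i , y) , fibre q , fibre r

-- A strictly monotone map of linear orders is an embedding.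
strict⇒embedding : ∀ C M (h : Carrier C → ∣ M ∣) →
  (∀ {x y} → x <[ C ] y → lt M (h x) (h y)) → IsEmbedding (le (toOrder C)) (le M) h
strict⇒embedding C M h mono x y = mk⇔
  [ proj₁ ∘ mono , (λ { refl → M.refl }) ]′ reflect
  where
  module M = DecTotalOrder M
  reflect : le M (h x) (h y) → le (toOrder C) x y
  reflect p with Chain.compare C x y
  ... | tri< q _ _ = inj₁ q
  ... | tri≈ _ q _ = inj₂ q
  ... | tri> _ _ q = let r , ¬r = mono q in contradiction (M.antisym r p) ¬r

embedding⇒strict : ∀ C D {h} → IsEmbedding (le (toOrder C)) (le (toOrder D)) h →
  ∀ {x y} → x <[ C ] y → h x <[ D ] h y
embedding⇒strict C D {h} emb {x} {y} p with to (emb x y) (inj₁ p)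
... | inj₁ q = q
... | inj₂ q with from (emb y x) (inj₂ (sym q))
...   | inj₁ r    = contradiction r (Chain.asym C p)
...   | inj₂ refl = contradiction p (Chain.irrefl C refl)

ofLO-≃ : ∀ L → toOrder (ofLO L) ≃ ⟦ LO⇒Lin L ⟧
ofLO-≃ L = record
  { fwd  = λ x → x
  ; emb  = strict⇒embedding (ofLO L) ⟦ LO⇒Lin L ⟧ (λ x → x) (λ p → p)
  ; surj = λ y → y , refl
  }

-- A monotone map from ℚ to a scattered order is not injective.
collapse : ExcludedMiddle 0ℓ → ∀ K → ¬ (ℚ.≤-decTotalOrder ≼ K) → (g : ℚ → ∣ K ∣) →
  (∀ {p q} → p ℚ.≤ q → le K (g p) (g q)) → ∃[ p ] ∃[ q ] p ℚ.< q × eq K (g p) (g q)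
collapse em K scattered g mono with em {∃[ p ] ∃[ q ] p ℚ.< q × eq K (g p) (g q)}
... | yes found = found
... | no ¬found = contradiction (g , λ p q → mk⇔ mono (reflect p q)) scattered
  where
  module K = DecTotalOrder K
  reflect : ∀ p q → le K (g p) (g q) → p ℚ.≤ q
  reflect p q r with p ℚ.≤? q
  ... | yes p≤q = p≤q
  ... | no p≰q  = let q<p = ℚ.≰⇒> p≰q in
    contradiction (q , p , q<p , K.antisym (mono (ℚ.<⇒≤ q<p)) r) ¬found

-- Finite blocks and convex partial isomorphisms

module Block (C : Chain) where
  open Chain C hiding (Carrier)
  private X = Carrier C

  -- y is the immediate successor of x.
  Covers : X → X → Set
  Covers x y = x <ᶜ y × ¬ (∃[ z ] x <ᶜ z × z <ᶜ y)

  -- From x one can pass to the immediate predecessor exactly n times; x and the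
  -- n points reached in this way lie above a.
  Down : X → ℕ → X → Set
  Down a zero    x = a <ᶜ x × ¬ (∃[ y ] Covers y x)
  Down a (suc n) x = ∃[ y ] Covers y x × Down a n y

  -- x is the top of a maximal block of n + 1 consecutive points, and this block
  -- lies strictly between a and b.
  IsBlock : X → X → ℕ → X → Set
  IsBlock a b n x = x <ᶜ b × ¬ (∃[ y ] Covers x y) × Down a n x

  covers-unique : ∀ {x y z} → Covers y x → Covers z x → y ≡ z
  covers-unique {x} {y} {z} (p , ¬p) (q , ¬q) with compare y z
  ... | tri< r _ _ = contradiction (z , r , q) ¬p
  ... | tri≈ _ r _ = r
  ... | tri> _ _ r = contradiction (y , r , p) ¬q

  down-unique : ∀ {a b} m n {x} → Down a m x → Down b n x → m ≡ n
  down-unique zero    zero    _ _ = refl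
  down-unique zero    (suc n) (_ , ¬p) (y , p , _) = contradiction (y , p) ¬p
  down-unique (suc m) zero    (y , p , _) (_ , ¬p) = contradiction (y , p) ¬p
  down-unique (suc m) (suc n) (y , p , d) (z , q , e)
    with refl ← covers-unique p q = cong suc (down-unique m n d e)

  a<down : ∀ {a} n {x} → Down a n x → a <ᶜ x
  a<down zero    (p , _)             = p
  a<down (suc n) (y , (y<x , _) , d) = <-trans (a<down n d) y<x

  a<block : ∀ {a b n x} → IsBlock a b n x → a <ᶜ x
  a<block {n = n} (_ , _ , d) = a<down n d

open Block using (Covers; Down; IsBlock)

-- R is the graph of an isomorphism between a convex part of C and a convex part
-- of D. The notion is symmetric; that R is functional and injective follows from
-- monotonicity, the orders being linear.
record ConvexIso (C D : Chain) (R : Carrier C → Carrier D → Set) : Set where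
  field
    mono   : ∀ {x x′ y y′} → R x y → R x′ y′ → x <[ C ] x′ → y <[ D ] y′
    comono : ∀ {x x′ y y′} → R x y → R x′ y′ → y <[ D ] y′ → x <[ C ] x′
    domain : ∀ {x x′ x″ y y″} → R x y → R x″ y″ → x <[ C ] x′ → x′ <[ C ] x″ → ∃[ y′ ] R x′ y′
    range  : ∀ {x x″ y y′ y″} → R x y → R x″ y″ → y <[ D ] y′ → y′ <[ D ] y″ → ∃[ x′ ] R x′ y′

flip-iso : ∀ {C D R} → ConvexIso C D R → ConvexIso D C (λ y x → R x y)
flip-iso r = record { mono = comono ; comono = mono ; domain = range ; range = domain }
  where open ConvexIso r

module _ {C D : Chain} {R : Carrier C → Carrier D → Set} (iso : ConvexIso C D R) where
  open ConvexIso iso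

  covers-transfer : ∀ {x x′ y y′} → R x y → R x′ y′ → Covers C x x′ → Covers D y y′
  covers-transfer r r′ (x<x′ , gap) = mono r r′ x<x′ , λ (w , y<w , w<y′) →
    let z , s = range r r′ y<w w<y′ in gap (z , comono r s y<w , comono s r′ w<y′)

module _ {C D : Chain} {R : Carrier C → Carrier D → Set} (iso : ConvexIso C D R) where
  open ConvexIso iso
  private
    module D = Chain D

  -- A neighbour of y in D lies within the range of R as soon as R reaches
  -- beyond y, hence comes from a neighbour in C.
  noSucc-transfer : ∀ {x y b b′} → R x y → R b b′ → x <[ C ] b →
    ¬ (∃[ x′ ] Covers C x x′) → ¬ (∃[ y′ ] Covers D y y′)
  noSucc-transfer {y = y} {b} {b′} r rb x<b none (w , c@(y<w , gap)) with D.compare w b′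
  ... | tri< w<b′ _ _ = let z , s = range r rb y<w w<b′ in
                        none (z , covers-transfer (flip-iso iso) r s c)
  ... | tri≈ _ refl _ = none (b , covers-transfer (flip-iso iso) r rb c)
  ... | tri> _ _ b′<w = gap (b′ , mono r rb x<b , b′<w)

  noPred-transfer : ∀ {x y a a′} → R x y → R a a′ → a <[ C ] x →
    ¬ (∃[ x′ ] Covers C x′ x) → ¬ (∃[ y′ ] Covers D y′ y)
  noPred-transfer {y = y} {a} {a′} r ra a<x none (w , c@(w<y , gap)) with D.compare w a′
  ... | tri< w<a′ _ _ = gap (a′ , w<a′ , mono ra r a<x)
  ... | tri≈ _ refl _ = none (a , covers-transfer (flip-iso iso) ra r c)
  ... | tri> _ _ a′<w = let z , s = range ra r a′<w w<y in
                        none (z , covers-transfer (flip-iso iso) s r c)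

  down-transfer : ∀ {a a′} n {x y} → R x y → R a a′ → Down C a n x → Down D a′ n y
  down-transfer zero    r ra (a<x , none) = mono ra r a<x , noPred-transfer r ra a<x none
  down-transfer (suc n) r ra (z , c@(z<x , _) , d) =
    let w , s = domain ra r (Block.a<down C n d) z<x in
    w , covers-transfer iso s r c , down-transfer n s ra d

  block-transfer : ∀ {a a′ b b′ n x y} → R a a′ → R b b′ → R x y →
    IsBlock C a b n x → IsBlock D a′ b′ n y
  block-transfer {n = n} ra rb r (x<b , none , d) =
    mono r rb x<b , noSucc-transfer r rb x<b none , down-transfer n r ra d

-- The order φ(L)

module Construction (em : ExcludedMiddle 0ℓ) (L₀ : LO) where

  B : Chain
  B = ofLO L₀

  B-countable : Carrier B ↣ ℕ
  B-countable = mk↣ (Numbering.injective (⟦⟧-numbering (LO⇒Lin L₀)))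

  -- A leading rational and a target.
  E : Chain
  E = lexSum ℚChain λ _ → lexSum B λ _ → B

  -- The indices of blocks; ((q , x , x′) , s) has target (x , x′).
  D : Chain
  D = lexSum E λ _ → ℚChain

  open DenseUnbounded (lexSum-denseUnbounded E ℚ-denseUnbounded)

  target : Carrier D → Carrier B × Carrier B
  target ((_ , x) , _) = x

  -- The leading rational of d is below that of e. Between two such indices there
  -- are indices with any given target.
  data _≪_ : Carrier D → Carrier D → Set where
    lead : ∀ {q q′ x x′ s s′} → q ℚ.< q′ → ((q , x) , s) ≪ ((q′ , x′) , s′)

  ≪⇒< : ∀ {d e} → d ≪ e → d <[ D ] e
  ≪⇒< (lead p) = base (base p)

  ≪-dense : ∀ {d e} x → d ≪ e → ∃[ m ] target m ≡ x × d ≪ m × m ≪ e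
  ≪-dense x (lead p) = let q , p₁ , p₂ = ℚ.<-dense p in ((q , x) , ℚ.0ℚ) , refl , lead p₁ , lead p₂

  ≪-next : ∀ d → ∃[ e ] d ≪ e
  ≪-next ((q , x) , s) = let q′ , p = DenseUnbounded.above ℚ-denseUnbounded q in ((q′ , x) , s) , lead p

  D-countable : Carrier D ↣ ℕ
  D-countable = Σ-countable
    (Σ-countable ℚ-countable λ _ → Σ-countable B-countable λ _ → B-countable) λ _ → ℚ-countable

  index-countable : Σ (Fin 2) (λ _ → Carrier D) ↣ ℕ
  index-countable = Σ-countable (Fin-countable 2) λ _ → D-countable

  open Injection index-countable using () renaming (to to index; injective to index-injective)

  -- In L₀ there is a maximal block of n + 1 points strictly between x and x′.
  HasBlock : Carrier B × Carrier B → ℕ → Set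
  HasBlock (x , x′) n = ∃[ z ] IsBlock B x x′ n z

  -- The number of points of a block, minus one. It determines (t , d), and its
  -- parity depends on whether L₀ already has a block of the odd candidate size
  -- between the two components of the target.
  size : Fin 2 → Carrier D → ℕ
  size t d with em {HasBlock (target d) (suc (double (index (t , d))))}
  ... | yes _ = double (index (t , d))
  ... | no  _ = suc (double (index (t , d)))

  size-cases : ∀ t d → let n = double (index (t , d)) in
    size t d ≡ n × HasBlock (target d) (suc n) ⊎ size t d ≡ suc n × ¬ HasBlock (target d) (suc n)
  size-cases t d with em {HasBlock (target d) (suc (double (index (t , d))))}
  ... | yes h = inj₁ (refl , h)
  ... | no ¬h = inj₂ (refl , ¬h)

  size-injective : ∀ t d t′ d′ → size t d ≡ size t′ d′ → (t , d) ≡ (t′ , d′)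
  size-injective t d t′ d′ p with size-cases t d | size-cases t′ d′
  ... | inj₁ (q , _) | inj₁ (r , _) =
    index-injective (double-injective _ _ (trans (sym q) (trans p r)))
  ... | inj₁ (q , _) | inj₂ (r , _) =
    contradiction (trans (sym q) (trans p r)) (double≢1+double _ (index (t′ , d′)))
  ... | inj₂ (q , _) | inj₁ (r , _) =
    contradiction (trans (sym r) (trans (sym p) q)) (double≢1+double _ (index (t , d)))
  ... | inj₂ (q , _) | inj₂ (r , _) =
    index-injective (double-injective _ _ (ℕ.suc-injective (trans (sym q) (trans p r))))

  -- Between the components of the target of d, either L₀ has a block of a size
  -- that no block in the halves has, or it has no block of the size of d.
  size-diagonal : ∀ t d →
    (∃[ n ] HasBlock (target d) n × (∀ t′ d′ → n ≢ size t′ d′)) ⊎ ¬ HasBlock (target d) (size t d)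
  size-diagonal t d with size-cases t d
  ... | inj₂ (q , ¬h) = inj₂ (¬h ∘ subst (HasBlock (target d)) q)
  ... | inj₁ (q , h)  = inj₁ (_ , h , missed)
    where
    missed : ∀ t′ d′ → suc (double (index (t , d))) ≢ size t′ d′
    missed t′ d′ p with size-cases t′ d′
    ... | inj₁ (r , _) = double≢1+double _ (index (t , d)) (sym (trans p r))
    ... | inj₂ (r , ¬h)
      with refl ← index-injective {t , d} {t′ , d′}
                    (double-injective _ _ (ℕ.suc-injective (trans p r))) = ¬h h

  -- The summands of one copy: L₀, followed by the two halves.
  part : Fin 3 → Chain
  part zero    = B
  part (suc t) = lexSum D λ d → finChain (suc (size t d))

  left right : Fin 2
  left  = zero
  right = suc zero

  low<half : ∀ t → zero <[ finChain 3 ] suc t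
  low<half _ = s≤s z≤n

  left<right : suc left <[ finChain 3 ] suc right
  left<right = s≤s (s≤s z≤n)

  -- The chain underlying φ(L), where A is the chain of L.
  Φ : Chain → Chain
  Φ A = lexSum A λ _ → lexSum (finChain 3) part

  -- The least and the greatest point of the block of index d, in half t of copy l.
  bottom top : ∀ A → Carrier A → Fin 2 → Carrier D → Carrier (Φ A)
  bottom A l t d = l , suc t , d , zero
  top    A l t d = l , suc t , d , fromℕ (size t d)

  module _ (A : Chain) where

    top-noSucc : ∀ {l t d} → ¬ (∃[ y ] Covers (Φ A) (top A l t d) y)
    top-noSucc {l} {t} {d} (_ , base p , gap) = let e , q = above d in
      gap (bottom A l t e , fibre (fibre (base q)) , base p)
    top-noSucc {l} {t} {d} (_ , fibre (base p) , gap) = let e , q = above d in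
      gap (bottom A l t e , fibre (fibre (base q)) , fibre (base p))
    top-noSucc {l} {t} {d} (_ , fibre (fibre (base p)) , gap) = let e , q , r = dense p in
      gap (bottom A l t e , fibre (fibre (base q)) , fibre (fibre (base r)))
    top-noSucc {l} {t} {d} (_ , fibre (fibre (fibre {y = i} p)) , gap) =
      contradiction (Fin.≤fromℕ i) (ℕ.<⇒≱ p)

    bottom-noPred : ∀ {l t d} → ¬ (∃[ y ] Covers (Φ A) y (bottom A l t d))
    bottom-noPred {l} {t} {d} (_ , base p , gap) = let e , q = below d in
      gap (bottom A l t e , base p , fibre (fibre (base q)))
    bottom-noPred {l} {t} {d} (_ , fibre (base p) , gap) = let e , q = below d in
      gap (bottom A l t e , fibre (base p) , fibre (fibre (base q)))
    bottom-noPred {l} {t} {d} (_ , fibre (fibre (base p)) , gap) = let e , q , r = dense p in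
      gap (bottom A l t e , fibre (fibre (base q)) , fibre (fibre (base r)))

    covers-inBlock : ∀ {l t d} (i : Fin (size t d)) →
      Covers (Φ A) (l , suc t , d , inject₁ i) (l , suc t , d , suc i)
    covers-inBlock i = fibre (fibre (fibre (s≤s (ℕ.≤-reflexive (Fin.toℕ-inject₁ i))))) , gap
      where
      Inj< : ∀ {j} → toℕ (inject₁ i) < j → ¬ j < suc (toℕ i)
      Inj< p q rewrite Fin.toℕ-inject₁ i = ℕ.<⇒≱ p (ℕ.s≤s⁻¹ q)

      gap : ¬ _
      gap (_ , p , q) with _ , refl , p , q ← lex-between p q
        with _ , refl , p , q ← lex-between p q
        with _ , refl , p , q ← lex-between p q = Inj< p q

    -- The i-th point of a block has i predecessors in it. The induction is on
    -- k = toℕ i, as inject₁ i is not a subterm of suc i.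
    down-inBlock : ∀ {a l t d} k i → toℕ i ≡ k → a <[ Φ A ] bottom A l t d →
      Down (Φ A) a k (l , suc t , d , i)
    down-inBlock zero    zero    refl p = p , bottom-noPred
    down-inBlock (suc k) (suc i) q    p = _ , covers-inBlock i ,
      down-inBlock k (inject₁ i) (trans (Fin.toℕ-inject₁ i) (ℕ.suc-injective q)) p

    top-isBlock : ∀ {a b l t d} → a <[ Φ A ] bottom A l t d → top A l t d <[ Φ A ] b →
      IsBlock (Φ A) a b (size t d) (top A l t d)
    top-isBlock p q = q , top-noSucc , down-inBlock _ _ (Fin.toℕ-fromℕ _) p

    -- Any top of a block in the halves is the expected one.
    block⇒top : ∀ {a b n l t d i} → IsBlock (Φ A) a b n (l , suc t , d , i) →
      n ≡ size t d × i ≡ fromℕ (size t d)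
    block⇒top {n = n} {l} {t} {d} {i} (_ , none , down) with view i
    ... | ‵fromℕ         = let e , p = below d in
          Block.down-unique (Φ A) n _ down
            (down-inBlock {bottom A l t e} _ _ (Fin.toℕ-fromℕ _) (fibre (fibre (base p)))) , refl
    ... | ‵inj₁ {i = j} _ = contradiction (_ , covers-inBlock j) none

    -- Each copy of L₀ is convex.
    low-iso : ∀ l → ConvexIso B (Φ A) (λ x y → y ≡ (l , zero , x))
    low-iso l = record
      { mono   = λ { refl refl p → fibre (fibre p) }
      ; comono = λ { refl refl p → lex-cancel (lex-cancel p) }
      ; domain = λ _ _ _ _ → _ , refl
      ; range  = rng
      }
      where
      rng : ∀ {x x″ : Carrier B} {y y′ y″ : Carrier (Φ A)} →
            y ≡ (l , zero , x) → y″ ≡ (l , zero , x″) →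
            y <[ Φ A ] y′ → y′ <[ Φ A ] y″ → ∃[ x′ ] y′ ≡ (l , zero , x′)
      rng refl refl p q with _ , refl , p , q ← lex-between p q
        with w , refl , _ ← lex-between p q = w , refl

  module _ {A A′ : Chain} {R : Carrier (Φ A) → Carrier (Φ A′) → Set}
           (iso : ConvexIso (Φ A) (Φ A′) R) where
    open ConvexIso iso

    abstract
      -- If a convex isomorphism is defined at two points of the same half of the same
      -- copy whose indices have different leading rationals, then beyond the first
      -- of them it maps the top of some block to the top of the block of the same
      -- half and the same index.
      matching : ∀ {l t e₀ e₁ i₀ i₁ y₀ y₁} →
        R (l , suc t , e₀ , i₀) y₀ → R (l , suc t , e₁ , i₁) y₁ → e₀ ≪ e₁ →
        ∃[ d ] ∃[ l′ ] e₀ <[ D ] d × R (top A l t d) (top A′ l′ t d)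
      matching {l} {t} {e₀} {e₁} r₀ r₁ e₀≪e₁ =
        let a , _ , e₀≪a , a≪e₁ = ≪-dense (target e₀) e₀≪e₁
            b , _ , a≪b , b≪e₁  = ≪-dense (target e₀) a≪e₁
            e₀<a = ≪⇒< e₀≪a
            e₀<b = Chain.<-trans D e₀<a (≪⇒< a≪b)
            _ , ru = reach e₀<a (≪⇒< a≪e₁)
            _ , rv = reach e₀<b (≪⇒< b≪e₁)
        in search e₀<a (≪⇒< a≪e₁) e₀<b (≪⇒< b≪e₁) a≪b ru rv
        where
        Goal : Set
        Goal = ∃[ d ] ∃[ l′ ] e₀ <[ D ] d × R (top A l t d) (top A′ l′ t d)

        reach : ∀ {d} → e₀ <[ D ] d → d <[ D ] e₁ → ∃[ y ] R (top A l t d) y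
        reach p q = domain r₀ r₁ (fibre (fibre (base p))) (fibre (fibre (base q)))

        -- A block that meets a half of the codomain is mapped onto a whole block,
        -- and the cardinality identifies that block.
        matched : ∀ {d l′ t′ d′ i′} → e₀ <[ D ] d → d <[ D ] e₁ →
          R (top A l t d) (l′ , suc t′ , d′ , i′) → Goal
        matched {d} {l′} {t′} {d′} p q r
          with n , refl ← block⇒top A′ (block-transfer iso r₀ r₁ r
                 (top-isBlock A (fibre (fibre (base p))) (fibre (fibre (base q)))))
          with refl ← size-injective t d t′ d′ n = d , l′ , p , r

        -- Unless one of the blocks a < b is matched, their tops are mapped into
        -- copies of L₀. If these copies differ, a half of the lower one lies
        -- between them; if they agree, the diagonal property applies.
        search : ∀ {a b u′ v′} → e₀ <[ D ] a → a <[ D ] e₁ → e₀ <[ D ] b → b <[ D ] e₁ → a ≪ b →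
          R (top A l t a) u′ → R (top A l t b) v′ → Goal
        search {u′ = _ , suc _ , _} p q _ _ _ ru _ = matched p q ru
        search {u′ = _ , zero , _} {_ , suc _ , _} _ _ p q _ _ rv = matched p q rv
        search {a} {b} {l₁ , zero , x} {l₂ , zero , x′} _ _ _ _ a≪b ru rv
          with mono ru rv (fibre (fibre (base (≪⇒< a≪b))))
        ... | base l₁<l₂ = ⊥-elim (pulledBack (range ru rv (fibre (base (low<half _))) (base l₁<l₂)))
          where
          -- The block of index a in copy l₁ comes from a block strictly above a,
          -- which would have the same size as a.
          pulledBack : ¬ (∃[ w ] R w (top A′ l₁ t a))
          pulledBack (w , rw)
            with _ , refl , p , q ← lex-between (comono ru rw (fibre (base (low<half _))))
                                                (comono rw rv (base l₁<l₂))
            with _ , refl , p , q ← lex-between p q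
            with n , refl ← block⇒top A (block-transfer (flip-iso iso) ru rv rw
                   (top-isBlock A′ (fibre (base (low<half _))) (base l₁<l₂)))
            with refl ← size-injective t a _ _ n = Chain.irrefl (part (suc t)) refl p
        ... | fibre (base ())
        ... | fibre (fibre _) with ≪-dense (x , x′) a≪b
        ...   | c , refl , a≪c , c≪b with size-diagonal t c
        ...     | inj₁ (n , (z , z-block) , missed) = ⊥-elim (pulledBack
                    (range ru rv (fibre (fibre (Block.a<block B z-block))) (fibre (fibre (proj₁ z-block)))))
          where
          -- L₀ has a block of a size that does not occur in the halves.
          pulledBack : ¬ (∃[ w ] R w (l₁ , zero , z))
          pulledBack (w , rw)
            with _ , refl , p , q ← lex-between
                   (comono ru rw (fibre (fibre (Block.a<block B z-block))))
                   (comono rw rv (fibre (fibre (proj₁ z-block))))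
            with _ , refl , p , q ← lex-between p q =
              missed _ _ (proj₁ (block⇒top A (block-transfer (flip-iso iso) ru rv rw
                (block-transfer (low-iso A′ l₁) refl refl refl z-block))))
        ...     | inj₂ ¬block = ⊥-elim (pushed (domain ru rv a<c c<b))
          where
          a<c : top A l t a <[ Φ A ] top A l t c
          a<c = fibre (fibre (base (≪⇒< a≪c)))

          c<b : top A l t c <[ Φ A ] top A l t b
          c<b = fibre (fibre (base (≪⇒< c≪b)))

          -- The block c would give L₀ a block of a size that it does not have there.
          pushed : ¬ (∃[ w ] R (top A l t c) w)
          pushed (w , rw)
            with blk ← block-transfer iso ru rv rw (top-isBlock A (fibre (fibre (base (≪⇒< a≪c)))) c<b)
            with _ , refl , p , q ← lex-between (mono ru rw a<c) (mono rw rv c<b)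
            with z , refl , _ ← lex-between p q =
              ¬block (z , block-transfer (flip-iso (low-iso A′ l₁)) refl refl refl blk)

-- φ preserves and reflects piecewise convex embeddability

module Main (em : ExcludedMiddle 0ℓ) (L₀ : LO) where
  open Construction em L₀

  b₀ : Carrier B
  b₀ = ⟦⟧-point (LO⇒Lin L₀)

  module _ (K : Order) (A A′ : Chain) where
    private module K = DecTotalOrder K

    preserve : toOrder A ⊴⟨ K ⟩ toOrder A′ → toOrder (Φ A) ⊴⟨ K ⟩ toOrder (Φ A′)
    preserve r = record
      { κ        = κ ∘ proj₁
      ; κ-mono   = λ p → κ-mono (≤-proj₁ A p)
      ; f        = F
      ; f-emb    = strict⇒embedding (Φ A) (toOrder (Φ A′)) F
                     λ p → inj₁ (F-mono p) , λ q → Chain.irrefl (Φ A′) q (F-mono p)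
      ; f-convex = λ {_} {_} {w} p u v →
          let y , q , s = f-convex p (≤-proj₁ A′ u) (≤-proj₁ A′ v) in
          (y , proj₂ w) , q , cong (_, proj₂ w) s
      }
      where
      open _⊴⟨_⟩_ r

      ≤-proj₁ : ∀ C {u v} → le (toOrder (Φ C)) u v → le (toOrder C) (proj₁ u) (proj₁ v)
      ≤-proj₁ C (inj₁ (base p))  = inj₁ p
      ≤-proj₁ C (inj₁ (fibre _)) = inj₂ refl
      ≤-proj₁ C (inj₂ refl)      = inj₂ refl

      F : Carrier (Φ A) → Carrier (Φ A′)
      F (l , x) = f l , x

      F-mono : ∀ {u v} → u <[ Φ A ] v → F u <[ Φ A′ ] F v
      F-mono (base p)  = base (embedding⇒strict A A′ f-emb p)
      F-mono (fibre p) = fibre p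

    module Reflect (scattered : ¬ (ℚ.≤-decTotalOrder ≼ K)) (r : toOrder (Φ A) ⊴⟨ K ⟩ toOrder (Φ A′)) where
      open _⊴⟨_⟩_ r

      f-strict : ∀ {x y} → x <[ Φ A ] y → f x <[ Φ A′ ] f y
      f-strict = embedding⇒strict (Φ A) (Φ A′) f-emb

      -- The restriction of f to the piece of index k.
      R : ∣ K ∣ → Carrier (Φ A) → Carrier (Φ A′) → Set
      R k x y = eq K k (κ x) × f x ≡ y

      iso : ∀ k → ConvexIso (Φ A) (Φ A′) (R k)
      iso k = record
        { mono   = λ { (_ , refl) (_ , refl) → f-strict }
        ; comono = λ { {x} {x′} (_ , refl) (_ , refl) p → reflected x x′ p }
        ; domain = λ { (p , refl) (q , refl) u v →
            _ , K.antisym (K.trans (K.reflexive p) (κ-mono (inj₁ u)))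
                          (K.trans (κ-mono (inj₁ v)) (K.reflexive (K.Eq.sym q))) , refl }
        ; range  = λ { (p , refl) (q , refl) u v →
            let x , s , e = f-convex (K.Eq.trans (K.Eq.sym p) q) (inj₁ u) (inj₁ v) in
            x , K.Eq.trans p s , e }
        }
        where
        reflected : ∀ x x′ → f x <[ Φ A′ ] f x′ → x <[ Φ A ] x′
        reflected x x′ p with from (f-emb x x′) (inj₁ p)
        ... | inj₁ q    = q
        ... | inj₂ refl = contradiction p (Chain.irrefl (Φ A′) refl)

      abstract
        -- Each half of each copy has a block that f maps to the block of the same index.
        fixed : ∀ t l → ∃[ d ] ∃[ l′ ] f (top A l t d) ≡ top A′ l′ t d
        fixed t l =
          let q , q′ , q<q′ , e = collapse em K scattered (κ ∘ bottom A l t ∘ at) mono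
              d , l′ , _ , _ , p = matching (iso (κ (bottom A l t (at q))))
                                     (K.Eq.refl , refl) (e , refl) (lead q<q′)
          in d , l′ , p
          where
          at : ℚ → Carrier D
          at q = (q , b₀ , b₀) , ℚ.0ℚ

          mono : ∀ {p q} → p ℚ.≤ q → le K (κ (bottom A l t (at p))) (κ (bottom A l t (at q)))
          mono {p} {q} p≤q with ℚ.<-cmp p q
          ... | tri< p<q _ _  = κ-mono (inj₁ (fibre (fibre (base (base (base p<q))))))
          ... | tri≈ _ refl _ = K.refl
          ... | tri> _ _ q<p  = contradiction (ℚ.<-≤-trans q<p p≤q) (ℚ.<-irrefl refl)

      -- The block chosen in the right half of copy l, its top, and the copy to
      -- which f maps it.
      index⁺ : Carrier A → Carrier D
      index⁺ = proj₁ ∘ fixed right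

      mark : Carrier A → Carrier (Φ A)
      mark l = top A l right (index⁺ l)

      h : Carrier A → Carrier A′
      h = proj₁ ∘ proj₂ ∘ fixed right

      f-mark : ∀ l → f (mark l) ≡ top A′ (h l) right (index⁺ l)
      f-mark = proj₂ ∘ proj₂ ∘ fixed right

      -- Between the images of the marks of l and m lies the image of a block in the
      -- left half of copy m, which is again in a left half.
      h-strict : ∀ {l m} → l <[ A ] m → h l <[ A′ ] h m
      h-strict {l} {m} l<m =
        let e , n , p = fixed left m in
        combine (subst₂ (less (Φ A′)) (f-mark l) p (f-strict (base l<m)))
                (subst₂ (less (Φ A′)) p (f-mark m) (f-strict (fibre (base left<right))))
        where
        combine : ∀ {n d e d′} → top A′ (h l) right d <[ Φ A′ ] top A′ n left e →
          top A′ n left e <[ Φ A′ ] top A′ (h m) right d′ → h l <[ A′ ] h m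
        combine (base p)                (base q)  = Chain.<-trans A′ p q
        combine (base p)                (fibre _) = p
        combine (fibre (base (s≤s ()))) _

      module _ {l₁ l₂ : Carrier A} {m : Carrier A′} (p : eq K (κ (mark l₁)) (κ (mark l₂)))
               (above : h l₁ <[ A′ ] m) (below : m <[ A′ ] h l₂) where

        k : ∣ K ∣
        k = κ (mark l₁)

        open ConvexIso (iso k)

        -- Copy m lies between the images of the marks of l₁ and l₂, hence within
        -- the range of the piece of index k.
        covered : ∀ t e → ∃[ x ] R k x (bottom A′ m t e)
        covered _ _ = range (K.Eq.refl , f-mark l₁) (p , f-mark l₂) (base above) (base below)

        onto : ∃[ l ] eq K k (κ (mark l)) × h l ≡ m
        onto =
          let e , ≪e = ≪-next (index⁺ l₁)
              d , l , _ , r = matching (flip-iso (iso k))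
                (proj₂ (covered left (index⁺ l₁))) (proj₂ (covered left e)) ≪e
              -- Starting at the index of the mark of l makes d′ lie above it.
              e′ , ≪e′ = ≪-next (index⁺ l)
              d′ , l′ , <d′ , r′ = matching (flip-iso (iso k))
                (proj₂ (covered right (index⁺ l))) (proj₂ (covered right e′)) ≪e′
          in l , finish r r′ <d′ (comono r r′ (fibre (base left<right)))
          where
          finish : ∀ {l l′ d d′} → R k (top A l left d) (top A′ m left d) →
            R k (top A l′ right d′) (top A′ m right d′) → index⁺ l <[ D ] d′ →
            top A l left d <[ Φ A ] top A l′ right d′ → eq K k (κ (mark l)) × h l ≡ m
          -- If l < l′, the right half of copy l lies in the domain, and a block in it
          -- above d′ would be mapped to a block below d′.
          finish {l} {l′} {d} {d′} r r′ _ (base l<l′) =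
            let e , d′≪e = ≪-next d′
                c , _ , d′<c , s = matching (iso k) (proj₂ (defined d′)) (proj₂ (defined e)) d′≪e
            in ⊥-elim (clash d′<c (mono r s (fibre (base left<right))) (mono s r′ (base l<l′)))
            where
            defined : ∀ e → ∃[ y ] R k (bottom A l right e) y
            defined e = domain r r′ (fibre (base left<right)) (base l<l′)

            clash : ∀ {c n} → d′ <[ D ] c → top A′ m left d <[ Φ A′ ] top A′ n right c →
              ¬ (top A′ n right c <[ Φ A′ ] top A′ m right d′)
            clash q u v with _ , refl , _ , v ← lex-between u v with lex-cancel v
            ... | base c<d′ = Chain.asym D q c<d′
            ... | fibre _   = Chain.irrefl D refl q
          -- If l = l′, the mark of l lies between the two matched blocks.
          finish {l} r r′ <d′ (fibre _)
            with u ← fibre (base left<right) | v ← fibre (fibre (base <d′))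
            with _ , k≈ , _ ← domain {x′ = mark l} r r′ u v
            with _ , e , _ ← lex-between (mono r (k≈ , f-mark l) u) (mono (k≈ , f-mark l) r′ v)
            = k≈ , cong proj₁ e

      reflect : toOrder A ⊴⟨ K ⟩ toOrder A′
      reflect = record
        { κ        = κ ∘ mark
        ; κ-mono   = [ (λ p → κ-mono (inj₁ (base p))) , (λ { refl → K.refl }) ]′
        ; f        = h
        ; f-emb    = strict⇒embedding A (toOrder A′) h
                       λ p → inj₁ (h-strict p) , λ q → Chain.irrefl A′ q (h-strict p)
        ; f-convex = convex
        }
        where
        convex : ∀ {l₁ l₂ m} → eq K (κ (mark l₁)) (κ (mark l₂)) →
          le (toOrder A′) (h l₁) m → le (toOrder A′) m (h l₂) →
          ∃[ l ] eq K (κ (mark l₁)) (κ (mark l)) × h l ≡ m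
        convex {l₁}      p (inj₂ q) _        = l₁ , K.Eq.refl , q
        convex {l₂ = l₂} p (inj₁ _) (inj₂ q) = l₂ , p , sym q
        convex           p (inj₁ u) (inj₁ v) = onto p u v

  -- A copy of L₀ in φ(L) is convex, so L₀ ⊴ φ(L) with a single piece.
  inCone : ∀ K → ∣ K ∣ → ∀ A → Carrier A → toOrder B ⊴⟨ K ⟩ toOrder (Φ A)
  inCone K k A l = record
    { κ        = λ _ → k
    ; κ-mono   = λ _ → DecTotalOrder.refl K
    ; f        = λ x → l , zero , x
    ; f-emb    = strict⇒embedding B (toOrder (Φ A)) _
                   λ p → inj₁ (fibre (fibre p)) , λ { refl → Chain.irrefl B refl p }
    ; f-convex = convex
    }
    where
    convex : ∀ {x z w} → eq K k k → le (toOrder (Φ A)) (l , zero , x) w →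
             le (toOrder (Φ A)) w (l , zero , z) → ∃[ y ] eq K k k × (l , zero , y) ≡ w
    convex {x}     e (inj₂ p) _        = x , e , p
    convex {z = z} e (inj₁ _) (inj₂ p) = z , e , sym p
    convex         e (inj₁ p) (inj₁ q) =
      let y , r = ConvexIso.range (low-iso A l) refl refl p q in y , e , sym r

  module _ (L : LO) where

    private A = ofLO L

    Φ-countable : Carrier (Φ A) ↣ ℕ
    Φ-countable = Σ-countable (mk↣ (Numbering.injective (⟦⟧-numbering (LO⇒Lin L)))) λ _ →
                  Σ-countable (Fin-countable 3) part-countable
      where
      part-countable : ∀ t → Carrier (part t) ↣ ℕ
      part-countable zero    = B-countable
      part-countable (suc t) = Σ-countable D-countable λ _ → Fin-countable _

    private
      ν : Numbering (toOrder (Φ A))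
      ν = record { num = Injection.to Φ-countable ; num-cong = cong _
                 ; injective = Injection.injective Φ-countable }

      unbounded : ∀ n → ∃[ x ] n ≤ Numbering.num ν x
      unbounded n = ((n , proj₂ (proj₂ L) n) , zero , b₀) , ℕ.<⇒≤ (a<pair n _)

    φ : LO
    φ = proj₁ (toLO em ν unbounded)

    φ-≃ : ⟦ LO⇒Lin φ ⟧ ≃ toOrder (Φ A)
    φ-≃ = proj₂ (toLO em ν unbounded)

theorem5p13 : ∀ {ℓ} → ExcludedMiddle (lsuc 0ℓ ⊔ ℓ) →
    (𝓛 : Pred Lin ℓ) → 𝓛 ⊆ Scat → Satisfiable 𝓛 →
    DownwardClosed 𝓛 → CCS 𝓛 →
    ∀ (L₀ : LO) → ⊴LO 𝓛 EmbedsInto ⊴Cone 𝓛 L₀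
theorem5p13 {ℓ} em 𝓛 scattered (K₀ , K₀∈𝓛) down _ L₀ =
  (λ L → φ L , cone L) , λ L L′ → mk⇔ (preserves L L′) (reflects L L′)
  where
  em₀ : ExcludedMiddle 0ℓ
  em₀ {P} = map′ lower lift (em {Lift (lsuc 0ℓ ⊔ ℓ) P})

  open Main em₀ L₀

  point : ∀ L → ∣ ⟦ LO⇒Lin L ⟧ ∣
  point L = ⟦⟧-point (LO⇒Lin L)

  cone : ∀ L → ⊴LO 𝓛 L₀ (φ L)
  cone L = fibres⇒⊴ em₀ 𝓛 down K₀ K₀∈𝓛 (point L₀)
    (⊴⟨⟩-resp-≃ (≃-sym (ofLO-≃ L₀)) (≃-sym (φ-≃ L))
      (inCone ⟦ K₀ ⟧ (⟦⟧-point K₀) (ofLO L) (point L)))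

  preserves : ∀ L L′ → ⊴LO 𝓛 L L′ → ⊴LO 𝓛 (φ L) (φ L′)
  preserves L L′ p = let K , K∈𝓛 , r = ⊴⇒fibres 𝓛 p in
    fibres⇒⊴ em₀ 𝓛 down K K∈𝓛 (point (φ L))
      (⊴⟨⟩-resp-≃ (φ-≃ L) (≃-sym (φ-≃ L′)) (preserve ⟦ K ⟧ (ofLO L) (ofLO L′)
        (⊴⟨⟩-resp-≃ (ofLO-≃ L) (≃-sym (ofLO-≃ L′)) r)))

  reflects : ∀ L L′ → ⊴LO 𝓛 (φ L) (φ L′) → ⊴LO 𝓛 L L′
  reflects L L′ p = let K , K∈𝓛 , r = ⊴⇒fibres 𝓛 p in
    fibres⇒⊴ em₀ 𝓛 down K K∈𝓛 (point L)
      (⊴⟨⟩-resp-≃ (≃-sym (ofLO-≃ L)) (ofLO-≃ L′)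
        (Reflect.reflect ⟦ K ⟧ (ofLO L) (ofLO L′) (scattered K∈𝓛)
          (⊴⟨⟩-resp-≃ (≃-sym (φ-≃ L)) (φ-≃ L′) r)))
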